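{- Let $d$ be a negative integer and let $e:=|d|$. Then the generating function $L_e(x,y)$ of the (nonempty) $d$-Dyck paths with respect to semi-length and number of peaks satisfies the functional equation $$L_e(x,y)= xy+xL_e(x,y)+xS_e(x,y)L_e(x,y),$$ where $S_e(x,y)$ satisfies the algebraic equation $$(1-xS_e(x,y))^e\bigl(y+(1-y)xS_e(x,y)\bigr)-S_e(x,y)(1-xS_e(x,y))^{e+1}-\frac{x^{e+2}y}{1-x}S_e(x,y)=0.$$
   Context: A Dyck path is a lattice path in the first quadrant that starts at the origin, ends on the $x$-axis, and consists of steps $U=(1,1)$ and $D=(1,-1)$ (never going below the $x$-axis). Its semi-length $\ell(P)$ is its number of $U$ steps. A peak is an occurrence of two consecutive steps $UD$; $\rho(P)$ denotes the number of peaks. A valley is an occurrence of two consecutive steps $DU$; the level of a valley is the $y$-coordinate of its lowest point. Let $\nu=(\nu_1,\dots,\nu_k)$ be the levels of all valleys of $P$, listed from left to right. For $d\in\mathbb Z$, a Dyck path is called $d$-Dyck if it has at most one valley or if $\nu_{i+1}-\nu_i\ge d$ for all $1\le i<k$. For $d<0$ and $e=|d|$, $L_e(x,y)=\sum_{P}x^{\ell(P)}y^{\rho(P)}$ (a formal power series), where $P$ runs over all nonempty $d$-Dyck paths. For $i\ge 0$, let $Q_i^{(e)}(x,y)=\sum_{P}x^{\ell(P)}y^{\rho(P)}$, where $P$ runs over all $d$-Dyck paths that have at least one valley and whose last (rightmost) valley is at level $i$. Define $$S_e(x,y)=\frac{y}{1-x}+\sum_{j=0}^{e-1}Q_j^{(e)}(x,y).$$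 -}

module Defs where

open import Algebra.Bundles.Raw using (RawRing)
import Algebra.Definitions.RawSemiring as RawSemiringDefs
open import Data.Empty using (⊥)
open import Data.Fin.Base using (toℕ)
open import Data.Integer.Base as ℤ using (ℤ; +_; 0ℤ; 1ℤ; ∣_∣)
import Data.Integer.Properties as ℤ
open import Algebra.Properties.CommutativeMonoid.Sum ℤ.+-0-commutativeMonoid
  using (sum⁺-syntax)
open import Data.List.Base using (List; []; _∷_; _++_; map; filter; length; last)
open import Data.List.Membership.Propositional using (_∈_)
open import Data.List.Membership.Propositional.Properties
  using (∈-map⁺; ∈-map⁻; ∈-++⁺ˡ; ∈-++⁺ʳ; ∈-++⁻)
open import Data.List.Relation.Unary.All using ([])
open import Data.List.Relation.Unary.Any using (here)
open import Data.List.Relation.Unary.Linked using (Linked; linked?)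
open import Data.List.Relation.Unary.Unique.Propositional using (Unique; []; _∷_)
open import Data.List.Relation.Unary.Unique.Propositional.Properties
  using (map⁺; ++⁺)
open import Data.Maybe.Base using (just)
open import Data.Maybe.Properties using (≡-dec)
open import Data.Nat.Base as ℕ using (ℕ; zero; suc; _∸_)
import Data.Nat.Properties as ℕ
open import Data.Product.Base using (_×_; _,_)
open import Data.Sum.Base using (inj₁; inj₂)
open import Level using (0ℓ)
open import Relation.Binary.PropositionalEquality
  using (_≡_; _≢_; refl; cong)
open import Relation.Nullary.Decidable using (yes; no; _×-dec_)
open import Relation.Unary using (Pred; Decidable)

-- A path from height h down to the x-axis that never goes below it;
-- being indexed by the current height, it can only take a step D
-- from a positive height.
data Path : ℕ → Set where
  end : Path 0
  U   : ∀ {h} → Path (suc h) → Path h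
  D   : ∀ {h} → Path h → Path (suc h)

DyckPath : Set
DyckPath = Path 0

semiLength : ∀ {h} → Path h → ℕ
semiLength end   = 0
semiLength (U p) = suc (semiLength p)
semiLength (D p) = semiLength p

peaks : ∀ {h} → Path h → ℕ
peaks end         = 0
peaks (U (U p))   = peaks (U p)
peaks (U (D p))   = suc (peaks (D p))
peaks (D p)       = peaks p

valleyLevels : ∀ {h} → Path h → List ℕ
valleyLevels end           = []
valleyLevels (U p)         = valleyLevels p
valleyLevels (D end)       = []
valleyLevels (D {h} (U p)) = h ∷ valleyLevels (U p)
valleyLevels (D (D p))     = valleyLevels (D p)

-- Linked R relates consecutive entries, and holds of any list with at
-- most one entry.
IsDyck : ℤ → Pred DyckPath 0ℓ
IsDyck d p = Linked (λ a b → d ℤ.≤ + b ℤ.- + a) (valleyLevels p)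

isDyck? : ∀ d → Decidable (IsDyck d)
isDyck? d p = linked? (λ a b → d ℤ.≤? + b ℤ.- + a) (valleyLevels p)

NonEmpty : Pred DyckPath 0ℓ
NonEmpty p = p ≢ end

nonEmpty? : Decidable NonEmpty
nonEmpty? end   = no λ end≢end → end≢end refl
nonEmpty? (U p) = yes λ ()

LastValleyAt : ℕ → Pred DyckPath 0ℓ
LastValleyAt i p = last (valleyLevels p) ≡ just i

lastValleyAt? : ∀ i → Decidable (LastValleyAt i)
lastValleyAt? i p = ≡-dec ℕ._≟_ (last (valleyLevels p)) (just i)

-- The paths from height h with n steps U, each listed exactly once
-- (∈-paths⁺, ∈-paths⁻ and paths-unique below).
paths : (n h : ℕ) → List (Path h)
paths zero    zero    = end ∷ []
paths zero    (suc h) = map D (paths zero h)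
paths (suc n) zero    = map U (paths n 1)
paths (suc n) (suc h) = map U (paths n (suc (suc h))) ++ map D (paths (suc n) h)

∈-paths⁺ : ∀ {h} (p : Path h) → p ∈ paths (semiLength p) h
∈-paths⁺ end               = here refl
∈-paths⁺ (U {zero} p)      = ∈-map⁺ U (∈-paths⁺ p)
∈-paths⁺ (U {suc h} p)     = ∈-++⁺ˡ (∈-map⁺ U (∈-paths⁺ p))
∈-paths⁺ (D {h} p) with semiLength p | ∈-paths⁺ p
... | zero  | p∈ = ∈-map⁺ D p∈
... | suc n | p∈ = ∈-++⁺ʳ (map U (paths n (suc (suc h)))) (∈-map⁺ D p∈)

∈-paths⁻ : ∀ n h {p : Path h} → p ∈ paths n h → semiLength p ≡ n
∈-paths⁻ zero zero (here refl) = refl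
∈-paths⁻ zero (suc h) p∈ with ∈-map⁻ D p∈
... | _ , q∈ , refl = ∈-paths⁻ zero h q∈
∈-paths⁻ (suc n) zero p∈ with ∈-map⁻ U p∈
... | _ , q∈ , refl = cong suc (∈-paths⁻ n 1 q∈)
∈-paths⁻ (suc n) (suc h) p∈ with ∈-++⁻ (map U (paths n (suc (suc h)))) p∈
... | inj₁ p∈U with ∈-map⁻ U p∈U
...   | _ , q∈ , refl = cong suc (∈-paths⁻ n (suc (suc h)) q∈)
∈-paths⁻ (suc n) (suc h) p∈ | inj₂ p∈D with ∈-map⁻ D p∈D
...   | _ , q∈ , refl = ∈-paths⁻ (suc n) h q∈

U-injective : ∀ {h} {p q : Path (suc h)} → U p ≡ U q → p ≡ q
U-injective refl = refl

D-injective : ∀ {h} {p q : Path h} → D p ≡ D q → p ≡ q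
D-injective refl = refl

paths-unique : ∀ n h → Unique (paths n h)
paths-unique zero    zero    = [] ∷ []
paths-unique zero    (suc h) = map⁺ D-injective (paths-unique zero h)
paths-unique (suc n) zero    = map⁺ U-injective (paths-unique n 1)
paths-unique (suc n) (suc h) =
  ++⁺ (map⁺ U-injective (paths-unique n (suc (suc h))))
      (map⁺ D-injective (paths-unique (suc n) h))
      disjoint
  where
  disjoint : ∀ {p} → p ∈ map U (paths n (suc (suc h))) × p ∈ map D (paths (suc n) h) → ⊥
  disjoint (p∈U , p∈D) with ∈-map⁻ U p∈U | ∈-map⁻ D p∈D
  ... | _ , _ , refl | _ , _ , ()

-- f n k is the coefficient of xⁿ yᵏ.
Series : Set
Series = ℕ → ℕ → ℤ

const : ℤ → Series
const c zero zero = c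
const c _    _    = 0ℤ

ℤ⟦x,y⟧ : RawRing 0ℓ 0ℓ
ℤ⟦x,y⟧ = record
  { Carrier = Series
  ; _≈_     = λ f g → ∀ n k → f n k ≡ g n k
  ; _+_     = λ f g n k → f n k ℤ.+ g n k
  ; _*_     = λ f g n k →
      ∑[ i ≤ n ] ∑[ j ≤ k ]
        (f (toℕ i) (toℕ j) ℤ.* g (n ∸ toℕ i) (k ∸ toℕ j))
  ; -_      = λ f n k → ℤ.- f n k
  ; 0#      = const 0ℤ
  ; 1#      = const 1ℤ
  }

open RawRing ℤ⟦x,y⟧ public using (_≈_; _+_; _*_; -_; 0#; 1#)
open RawSemiringDefs (RawRing.rawSemiring ℤ⟦x,y⟧) public using (_^_; sum)

infixl 6 _-_
_-_ : Series → Series → Series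
f - g = f + (- g)

x : Series
x 1 0 = 1ℤ
x _ _ = 0ℤ

y : Series
y 0 1 = 1ℤ
y _ _ = 0ℤ

-- The series Σₙ xⁿ.
1/[1-x] : Series
1/[1-x] _ zero    = 1ℤ
1/[1-x] _ (suc _) = 0ℤ

-- The sum of x^ℓ(p) y^ρ(p) over the Dyck paths p satisfying P.
genFun : {P : Pred DyckPath 0ℓ} → Decidable P → Series
genFun P? n k = + length (filter (λ p → P? p ×-dec (peaks p ℕ.≟ k)) (paths n 0))

-- L d, Q d i and S d are the series L_e, Q_i^(e) and S_e for e = ∣ d ∣, d < 0.
L : ℤ → Series
L d = genFun λ p → nonEmpty? p ×-dec isDyck? d p

Q : ℤ → ℕ → Series
Q d i = genFun λ p → isDyck? d p ×-dec lastValleyAt? i p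

S : ℤ → Series
S d = y * 1/[1-x] + sum {∣ d ∣} λ j → Q d (toℕ j)

{-# OPTIONS --safe #-}
module Submission where

-- Cut a nonempty Dyck path at its first return to the x-axis:
-- P = U A D B with A and B Dyck paths (_▸_, ∑∈-paths-split).  The peaks of
-- P are those of U A D together with those of B.  The valleys of P are
-- those of A, one level higher, followed, if B is nonempty, by a valley at
-- level 0 and the valleys of B.  So if a weight of the list of valley
-- levels is multiplicative at the level-0 valley, then the series it
-- defines satisfies a functional equation (gf-mark-firstReturn).
--
-- Let d = - e < 0.  A valley at level 0 may be followed by any valley, and
-- may come after the last valley of the raised A just when that valley is
-- at level at most e, that is, when the last valley of A, if there is one,
-- is at level below e.  The paths U A D for such d-Dyck A contribute x S:
-- A is empty, or a nonempty path without valleys, or counted by some Q j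
-- with j < e, and the first two kinds give y + N = y/(1-x), where
-- N = xy/(1-x) counts the nonempty paths without valleys (𝒮-equation,
-- S≈𝒮).  Cutting the paths counted by L, N, Q 0 and Q (i+1) gives
--   L = x (y + L + S L),       N = x (y + N),
--   Q 0 = x S (N + Q 0),       Q (i+1) = x (Q i + S Q (i+1)).
-- The first of these is the functional equation of L.  With W = 1 - x S
-- the last two say W (Q 0) = x S N and W (Q (i+1)) = x (Q i), so the sum
-- T of the Q j with j < e is a geometric sum, and
--   W^e (W T) + x^e (x S N) = W^e (x T + x S N)
-- (geometricSum).  Eliminating T by means of S = y/(1-x) + T and N by
-- means of N = xy/(1-x) leaves the algebraic equation of S (elimination).
--
-- The calculation takes place in a commutative ring, so the series in x
-- and y are first shown to form one: up to the identity map they are the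
-- power series in x over the power series in y over the integers.

open import Algebra.Bundles using (CommutativeRing)
import Algebra.Construct.Pointwise as Pointwise
import Algebra.Morphism.RingMonomorphism as RingMonomorphism
open import Algebra.Morphism.Structures using (IsRingMonomorphism)
import Algebra.Properties.CommutativeSemigroup as CommutativeSemigroupProperties
import Algebra.Properties.Ring as RingProperties
import Algebra.Properties.Semiring.Exp as SemiringExp
import Algebra.Properties.Semiring.Sum as SemiringSum
import Algebra.Solver.Ring.NaturalCoefficients.Default as SemiringSolver
open import Algebra.Structures using (IsCommutativeRing)
open import Data.Bool.Base using (Bool; true; false; _∧_; if_then_else_)
import Data.Bool.Properties as Bool
open import Data.Fin.Base using (Fin; zero; suc; toℕ)
open import Data.Integer.Base as ℤ using (-[1+_]; +_; 1ℤ)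
import Data.Integer.Properties as ℤ
open import Data.List.Base
  using (List; []; _∷_; _++_; map; foldr; filter; length; last; null)
open import Data.List.Relation.Unary.Linked using (linked?)
open import Data.Maybe.Base using (Maybe; just; nothing; maybe′)
open import Data.Maybe.Properties using (≡-dec)
open import Data.Nat.Base as ℕ using (ℕ; zero; suc; _∸_)
import Data.Nat.Properties as ℕ
open import Data.Product.Base using (_,_)
open import Function.Base using (_∘_)
open import Level using (0ℓ)
import Relation.Binary.Reasoning.Setoid as SetoidReasoning
open import Relation.Binary.PropositionalEquality as ≡ using (_≡_; cong; cong₂)
open import Relation.Nullary.Decidable using (does; _×-dec_)
open import Relation.Unary using (Pred; Decidable)

open import Defs using (Path; end; U; D; DyckPath; paths; peaks; valleyLevels)

-- Formal power series over a commutative ring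

module PowerSeries {c ℓ} (R : CommutativeRing c ℓ) where

  open CommutativeRing R hiding (zero)
  open SemiringSum semiring
  open CommutativeSemigroupProperties +-commutativeSemigroup using (x∙yz≈y∙xz)
  open SetoidReasoning setoid

  infix  4 _≋_
  infixl 6 _⊕_
  infixl 7 _⊛_

  -- A series with coefficients in R in a variable X: f n is the
  -- coefficient of Xⁿ.
  R⟦X⟧ : Set c
  R⟦X⟧ = ℕ → Carrier

  _≋_ : R⟦X⟧ → R⟦X⟧ → Set ℓ
  f ≋ g = ∀ n → f n ≈ g n

  _⊕_ : R⟦X⟧ → R⟦X⟧ → R⟦X⟧
  (f ⊕ g) n = f n + g n

  ⊖_ : R⟦X⟧ → R⟦X⟧
  (⊖ f) n = - f n

  -- The summands of the coefficient of Xⁿ in the product of f and g.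
  term : R⟦X⟧ → R⟦X⟧ → ∀ n → Fin (suc n) → Carrier
  term f g n i = f (toℕ i) * g (n ∸ toℕ i)

  -- The product f ⊛ g satisfies, by computation,
  -- (f ⊛ g) (suc n) = f 0 * g (suc n) + ((f ∘ suc) ⊛ g) n,
  -- on which the inductions below rest.
  _⊛_ : R⟦X⟧ → R⟦X⟧ → R⟦X⟧
  (f ⊛ g) n = sum (term f g n)

  0S : R⟦X⟧
  0S _ = 0#

  -- The series a, with zero coefficients from X on.
  constant : Carrier → R⟦X⟧
  constant a zero    = a
  constant a (suc _) = 0#

  1S : R⟦X⟧
  1S = constant 1#

  X : R⟦X⟧
  X zero    = 0#
  X (suc n) = 1S n

  ⊛-cong : ∀ {f f′ g g′} → f ≋ f′ → g ≋ g′ → f ⊛ g ≋ f′ ⊛ g′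
  ⊛-cong f≋f′ g≋g′ n =
    sum-cong-≋ {suc n} λ i → *-cong (f≋f′ (toℕ i)) (g≋g′ (n ∸ toℕ i))

  ⊛-zeroˡ : ∀ {f} → f ≋ 0S → ∀ g → f ⊛ g ≋ 0S
  ⊛-zeroˡ {f} f≋0 g n = begin
    (f ⊛ g) n                     ≈⟨ sum-cong-≋ {suc n} (λ i → trans (*-congʳ (f≋0 (toℕ i))) (zeroˡ (g (n ∸ toℕ i)))) ⟩
    ∑[ i ≤ n ] 0#                 ≈⟨ sum-replicate-zero (suc n) ⟩
    0#                            ∎

  constant-⊛ : ∀ a f n → (constant a ⊛ f) n ≈ a * f n
  constant-⊛ a f zero    = +-identityʳ _
  constant-⊛ a f (suc n) =
    trans (+-congˡ (⊛-zeroˡ (λ _ → refl) f n)) (+-identityʳ _)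

  X⊛-zero : ∀ f → (X ⊛ f) 0 ≈ 0#
  X⊛-zero f = trans (+-identityʳ _) (zeroˡ _)

  X⊛-suc : ∀ f n → (X ⊛ f) (suc n) ≈ f n
  X⊛-suc f n = begin
    0# * f (suc n) + (1S ⊛ f) n ≈⟨ +-cong (zeroˡ _) (constant-⊛ 1# f n) ⟩
    0# + 1# * f n               ≈⟨ +-identityˡ _ ⟩
    1# * f n                    ≈⟨ *-identityˡ _ ⟩
    f n                         ∎

  scale-⊛ : ∀ a f g n → ((λ m → a * f m) ⊛ g) n ≈ a * (f ⊛ g) n
  scale-⊛ a f g n = trans
    (sum-cong-≋ {suc n} λ i → *-assoc a (f (toℕ i)) (g (n ∸ toℕ i)))
    (sym (*-distribˡ-sum {suc n} a (term f g n)))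

  ⊛-distribˡ : ∀ f g h → f ⊛ (g ⊕ h) ≋ (f ⊛ g) ⊕ (f ⊛ h)
  ⊛-distribˡ f g h n = trans
    (sum-cong-≋ {suc n} λ i → distribˡ (f (toℕ i)) (g (n ∸ toℕ i)) (h (n ∸ toℕ i)))
    (∑-distrib-+ {suc n} (term f g n) (term f h n))

  ⊛-distribʳ : ∀ h f g → (f ⊕ g) ⊛ h ≋ (f ⊛ h) ⊕ (g ⊛ h)
  ⊛-distribʳ h f g n = trans
    (sum-cong-≋ {suc n} λ i → distribʳ (h (n ∸ toℕ i)) (f (toℕ i)) (g (toℕ i)))
    (∑-distrib-+ {suc n} (term f h n) (term g h n))

  ⊛-comm : ∀ f g → f ⊛ g ≋ g ⊛ f
  ⊛-comm f g zero          = +-congʳ (*-comm _ _)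
  ⊛-comm f g (suc zero)    = begin
    f 0 * g 1 + (f 1 * g 0 + 0#) ≈⟨ x∙yz≈y∙xz _ _ _ ⟩
    f 1 * g 0 + (f 0 * g 1 + 0#) ≈⟨ +-cong (*-comm _ _) (+-congʳ (*-comm _ _)) ⟩
    g 0 * f 1 + (g 1 * f 0 + 0#) ∎
  ⊛-comm f g (suc (suc n)) = begin
    f 0 * g (2+ n) + ((f ∘ suc) ⊛ g) (suc n)
      ≈⟨ +-congˡ (⊛-comm (f ∘ suc) g (suc n)) ⟩
    f 0 * g (2+ n) + (g 0 * f (2+ n) + ((g ∘ suc) ⊛ (f ∘ suc)) n)
      ≈⟨ x∙yz≈y∙xz _ _ _ ⟩
    g 0 * f (2+ n) + (f 0 * g (2+ n) + ((g ∘ suc) ⊛ (f ∘ suc)) n)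
      ≈⟨ +-congˡ (+-congˡ (⊛-comm (g ∘ suc) (f ∘ suc) n)) ⟩
    g 0 * f (2+ n) + (f ⊛ (g ∘ suc)) (suc n)
      ≈⟨ +-congˡ (⊛-comm f (g ∘ suc) (suc n)) ⟩
    g 0 * f (2+ n) + ((g ∘ suc) ⊛ f) (suc n) ∎
    where
    2+ : ℕ → ℕ
    2+ k = suc (suc k)

  ⊛-assoc : ∀ f g h → (f ⊛ g) ⊛ h ≋ f ⊛ (g ⊛ h)
  ⊛-assoc f g h zero    = +-congʳ (begin
    (f 0 * g 0 + 0#) * h 0 ≈⟨ *-congʳ (+-identityʳ _) ⟩
    f 0 * g 0 * h 0        ≈⟨ *-assoc _ _ _ ⟩
    f 0 * (g 0 * h 0)      ≈⟨ *-congˡ (+-identityʳ _) ⟨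
    f 0 * (g 0 * h 0 + 0#) ∎)
  ⊛-assoc f g h (suc n) = begin
    (f 0 * g 0 + 0#) * h (suc n) + (((λ m → f 0 * g (suc m)) ⊕ ((f ∘ suc) ⊛ g)) ⊛ h) n
      ≈⟨ +-cong (trans (*-congʳ (+-identityʳ _)) (*-assoc _ _ _)) (⊛-distribʳ h (λ m → f 0 * g (suc m)) ((f ∘ suc) ⊛ g) n) ⟩
    f 0 * (g 0 * h (suc n)) + (((λ m → f 0 * g (suc m)) ⊛ h) n + (((f ∘ suc) ⊛ g) ⊛ h) n)
      ≈⟨ +-assoc _ _ _ ⟨
    f 0 * (g 0 * h (suc n)) + ((λ m → f 0 * g (suc m)) ⊛ h) n + (((f ∘ suc) ⊛ g) ⊛ h) n
      ≈⟨ +-cong (+-congˡ (scale-⊛ (f 0) (g ∘ suc) h n)) (⊛-assoc (f ∘ suc) g h n) ⟩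
    f 0 * (g 0 * h (suc n)) + f 0 * ((g ∘ suc) ⊛ h) n + ((f ∘ suc) ⊛ (g ⊛ h)) n
      ≈⟨ +-congʳ (distribˡ _ _ _) ⟨
    f 0 * (g ⊛ h) (suc n) + ((f ∘ suc) ⊛ (g ⊛ h)) n ∎

  ⊛-identityˡ : ∀ f → 1S ⊛ f ≋ f
  ⊛-identityˡ f n = trans (constant-⊛ 1# f n) (*-identityˡ _)

  ⊛-identityʳ : ∀ f → f ⊛ 1S ≋ f
  ⊛-identityʳ f n = trans (⊛-comm f 1S n) (⊛-identityˡ f n)

  R⟦X⟧-isCommutativeRing : IsCommutativeRing _≋_ _⊕_ _⊛_ ⊖_ 0S 1S
  R⟦X⟧-isCommutativeRing = record
    { isRing = record
      { +-isAbelianGroup = Pointwise.isAbelianGroup ℕ +-isAbelianGroup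
      ; *-cong           = ⊛-cong
      ; *-assoc          = ⊛-assoc
      ; *-identity       = ⊛-identityˡ , ⊛-identityʳ
      ; distrib          = ⊛-distribˡ , ⊛-distribʳ
      }
    ; *-comm = ⊛-comm
    }

  R⟦X⟧-commutativeRing : CommutativeRing c ℓ
  R⟦X⟧-commutativeRing = record { isCommutativeRing = R⟦X⟧-isCommutativeRing }

  module Series = CommutativeRing R⟦X⟧-commutativeRing
  module SeriesSum = SemiringSum Series.semiring

  sum-coefficient : ∀ {m} (t : Fin m → R⟦X⟧) n → SeriesSum.sum t n ≈ ∑[ i < m ] t i n
  sum-coefficient {zero}  t n = refl
  sum-coefficient {suc m} t n = +-congˡ (sum-coefficient (t ∘ suc) n)

-- The system of functional equations in a commutative ring

module FunctionalEquations {c ℓ} (A : CommutativeRing c ℓ) where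

  open CommutativeRing A hiding (zero)
  open RingProperties ring
  open SemiringExp semiring using (_^_)
  open SemiringSum semiring using (sum)
  open SemiringSolver commutativeSemiring using (solve; _:=_; _:+_; _:*_; con)
  open SetoidReasoning setoid

  expand : ∀ x y l s → x * (y + l + s * l) ≈ x * y + x * l + x * s * l
  expand = solve 4 (λ x y l s →
    x :* (y :+ l :+ s :* l) := x :* y :+ x :* l :+ x :* s :* l) refl

  -- Here g plays the role of 1/(1-x).
  geometric : ∀ x g a z → g ≈ 1# + x * g → z ≈ x * (a + z) → z ≈ x * (a * g)
  geometric x g a z g-eq z-eq = +-cancelʳ (x * g * z) z (x * (a * g)) (begin
    z + x * g * z               ≈⟨ solve 3 (λ x g z → z :+ x :* g :* z := (con 1 :+ x :* g) :* z) refl x g z ⟩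
    (1# + x * g) * z            ≈⟨ *-congʳ g-eq ⟨
    g * z                       ≈⟨ *-congˡ z-eq ⟩
    g * (x * (a + z))           ≈⟨ solve 4 (λ x g a z → g :* (x :* (a :+ z)) := x :* (a :* g) :+ x :* g :* z) refl x g a z ⟩
    x * (a * g) + x * g * z     ∎)

  -- If w = 1 - s, then z = a + s z says that w z = a.
  complement : ∀ {w s a z} → w + s ≈ 1# → z ≈ a + s * z → w * z ≈ a
  complement {w} {s} {a} {z} w+s z-eq = +-cancelʳ (s * z) (w * z) a (begin
    w * z + s * z ≈⟨ distribʳ z w s ⟨
    (w + s) * z   ≈⟨ *-congʳ w+s ⟩
    1# * z        ≈⟨ *-identityˡ z ⟩
    z             ≈⟨ z-eq ⟩
    a + s * z     ∎)

  -- The sum T of the first e terms of a geometric progression of ratio x / w,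
  -- with denominators cleared: (w - x) T = w q₀ (1 - (x/w)ᵉ).
  geometricSum : ∀ {w x} (q : ℕ → Carrier) → (∀ i → w * q (suc i) ≈ x * q i) → ∀ e →
    let T = sum {e} λ j → q (toℕ j) in
    w ^ e * (w * T) + x ^ e * (w * q 0) ≈ w ^ e * (x * T + w * q 0)
  geometricSum {w} {x} q q-eq zero =
    solve 3 (λ w x a → con 1 :* (w :* con 0) :+ con 1 :* a := con 1 :* (x :* con 0 :+ a)) refl w x (w * q 0)
  geometricSum {w} {x} q q-eq (suc e) = begin
    w * W * (w * (q 0 + T)) + x * Xᵉ * (w * q 0)
      ≈⟨ solve 6 (λ w x W Xᵉ q₀ T →
           w :* W :* (w :* (q₀ :+ T)) :+ x :* Xᵉ :* (w :* q₀)
           := w :* (W :* (w :* T) :+ Xᵉ :* (x :* q₀)) :+ w :* W :* (w :* q₀)) refl w x W Xᵉ (q 0) T ⟩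
    w * (W * (w * T) + Xᵉ * (x * q 0)) + w * W * (w * q 0)
      ≈⟨ +-congʳ (*-congˡ (+-congˡ (*-congˡ (q-eq 0)))) ⟨
    w * (W * (w * T) + Xᵉ * (w * q 1)) + w * W * (w * q 0)
      ≈⟨ +-congʳ (*-congˡ (geometricSum (q ∘ suc) (q-eq ∘ suc) e)) ⟩
    w * (W * (x * T + w * q 1)) + w * W * (w * q 0)
      ≈⟨ +-congʳ (*-congˡ (*-congˡ (+-congˡ (q-eq 0)))) ⟩
    w * (W * (x * T + x * q 0)) + w * W * (w * q 0)
      ≈⟨ solve 5 (λ w x W q₀ T →
           w :* (W :* (x :* T :+ x :* q₀)) :+ w :* W :* (w :* q₀)
           := w :* W :* (x :* (q₀ :+ T) :+ w :* q₀)) refl w x W (q 0) T ⟩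
    w * W * (x * (q 0 + T) + w * q 0) ∎
    where
    W = w ^ e
    Xᵉ = x ^ e
    T = sum {e} λ j → q (suc (toℕ j))

  -- The last two equations make the q i a geometric progression of ratio
  -- x / w with w = 1 - x S.
  elimination : ∀ x y g N (q : ℕ → Carrier) S e →
    S ≈ y * g + sum {e} (λ j → q (toℕ j)) →
    g ≈ 1# + x * g →
    N ≈ x * (y * g) →
    q 0 ≈ x * (S * (N + q 0)) →
    (∀ i → q (suc i) ≈ x * (q i + S * q (suc i))) →
    (1# - x * S) ^ e * (y + (1# - y) * (x * S)) - S * (1# - x * S) ^ suc e
      - x ^ suc (suc e) * y * g * S ≈ 0#
  elimination x y g N q S e S-eq g-eq N-eq q₀-eq qₛ-eq = begin
    E - F - G     ≈⟨ +-assoc E (- F) (- G) ⟩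
    E + (- F - G) ≈⟨ +-congˡ (-‿+-comm F G) ⟩
    E - (F + G)   ≈⟨ +-congʳ E≈F+G ⟩
    F + G - (F + G) ≈⟨ -‿inverseʳ (F + G) ⟩
    0#            ∎
    where
    T = sum {e} λ j → q (toℕ j)
    w = 1# - x * S
    W = w ^ e
    E = W * (y + (1# - y) * (x * S))
    F = S * w ^ suc e
    G = x ^ suc (suc e) * y * g * S

    complementary : ∀ a → 1# - a + a ≈ 1#
    complementary a = trans (+-assoc 1# (- a) a)
      (trans (+-congˡ (-‿inverseˡ a)) (+-identityʳ 1#))

    w+xS : w + x * S ≈ 1#
    w+xS = complementary (x * S)

    q-ratio : ∀ i → w * q (suc i) ≈ x * q i
    q-ratio i = complement w+xS (trans (qₛ-eq i)
      (solve 4 (λ x S q q′ → x :* (q :+ S :* q′) := x :* q :+ x :* S :* q′) refl x S (q i) (q (suc i))))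

    w*q₀ : w * q 0 ≈ x * (x * (y * g)) * S
    w*q₀ = complement w+xS (begin
      q 0                                       ≈⟨ q₀-eq ⟩
      x * (S * (N + q 0))                       ≈⟨ *-congˡ (*-congˡ (+-congʳ N-eq)) ⟩
      x * (S * (x * (y * g) + q 0))
        ≈⟨ solve 5 (λ x y g S q → x :* (S :* (x :* (y :* g) :+ q)) := x :* (x :* (y :* g)) :* S :+ x :* S :* q) refl x y g S (q 0) ⟩
      x * (x * (y * g)) * S + x * S * q 0       ∎)

    -- E and F + G are both the product of W and w * y + x * S.  The
    -- differences 1 - x S and 1 - y enter the calculation only through
    -- complementary, so that semiring identities suffice.
    bracketᴱ : y + (1# - y) * (x * S) ≈ w * y + x * S
    bracketᴱ = begin
      y + (1# - y) * (x * S)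
        ≈⟨ +-congʳ (trans (*-congʳ w+xS) (*-identityˡ y)) ⟨
      (w + x * S) * y + (1# - y) * (x * S)
        ≈⟨ solve 4 (λ w s y u → (w :+ s) :* y :+ u :* s := w :* y :+ (u :+ y) :* s) refl w (x * S) y (1# - y) ⟩
      w * y + (1# - y + y) * (x * S)
        ≈⟨ +-congˡ (trans (*-congʳ (complementary y)) (*-identityˡ _)) ⟩
      w * y + x * S ∎

    bracketᶠ : w * (y * g) + (x * T + w * q 0) ≈ w * y + x * S
    bracketᶠ = begin
      w * (y * g) + (x * T + w * q 0)
        ≈⟨ +-cong (*-congˡ (*-congˡ g-eq)) (+-congˡ w*q₀) ⟩
      w * (y * (1# + x * g)) + (x * T + x * (x * (y * g)) * S)
        ≈⟨ solve 6 (λ w x y g T S →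
             w :* (y :* (con 1 :+ x :* g)) :+ (x :* T :+ x :* (x :* (y :* g)) :* S)
             := w :* y :+ (x :* ((w :+ x :* S) :* (y :* g)) :+ x :* T)) refl w x y g T S ⟩
      w * y + (x * ((w + x * S) * (y * g)) + x * T)
        ≈⟨ +-congˡ (+-congʳ (*-congˡ (trans (*-congʳ w+xS) (*-identityˡ _)))) ⟩
      w * y + (x * (y * g) + x * T)
        ≈⟨ +-congˡ (trans (*-congˡ S-eq) (distribˡ x (y * g) T)) ⟨
      w * y + x * S ∎

    E≈F+G : E ≈ F + G
    E≈F+G = begin
      W * (y + (1# - y) * (x * S))
        ≈⟨ *-congˡ (trans bracketᴱ (sym bracketᶠ)) ⟩
      W * (w * (y * g) + (x * T + w * q 0))
        ≈⟨ distribˡ W _ _ ⟩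
      W * (w * (y * g)) + W * (x * T + w * q 0)
        ≈⟨ +-congˡ (geometricSum q q-ratio e) ⟨
      W * (w * (y * g)) + (W * (w * T) + x ^ e * (w * q 0))
        ≈⟨ +-congˡ (+-congˡ (*-congˡ w*q₀)) ⟩
      W * (w * (y * g)) + (W * (w * T) + x ^ e * (x * (x * (y * g)) * S))
        ≈⟨ solve 8 (λ W w x y g T S Xᵉ →
             W :* (w :* (y :* g)) :+ (W :* (w :* T) :+ Xᵉ :* (x :* (x :* (y :* g)) :* S))
             := (y :* g :+ T) :* (w :* W) :+ x :* (x :* Xᵉ) :* y :* g :* S)
             refl W w x y g T S (x ^ e) ⟩
      (y * g + T) * (w * W) + G
        ≈⟨ +-congʳ (*-congʳ S-eq) ⟨
      F + G ∎

-- The first return decomposition of Dyck paths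

infixr 5 _▸_

-- The path A D B, with A raised by one level.
_▸_ : ∀ {h} → Path h → DyckPath → Path (suc h)
end ▸ B = D B
U A ▸ B = U (A ▸ B)
D A ▸ B = D (A ▸ B)

-- The number of peaks of U A D.
peaks⁺ : DyckPath → ℕ
peaks⁺ A = peaks (U (A ▸ end))

peaks-▸ : ∀ {h} (A : Path h) B → peaks (A ▸ B) ≡ peaks A ℕ.+ peaks B
peaks-▸ end       B = ≡.refl
peaks-▸ (U (U A)) B = peaks-▸ (U A) B
peaks-▸ (U (D A)) B = cong suc (peaks-▸ (D A) B)
peaks-▸ (D A)     B = peaks-▸ A B

peaks⁺-U : ∀ A → peaks⁺ (U A) ≡ peaks (U A)
peaks⁺-U A = ≡.trans (peaks-▸ (U A) end) (ℕ.+-identityʳ _)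

peaks-U▸ : ∀ A B → peaks (U (A ▸ B)) ≡ peaks⁺ A ℕ.+ peaks B
peaks-U▸ end   B = ≡.refl
peaks-U▸ (U A) B = ≡.trans (peaks-▸ (U A) B) (cong (ℕ._+ peaks B) (≡.sym (peaks⁺-U A)))

valleyLevels-▸end : ∀ {h} (A : Path h) → valleyLevels (A ▸ end) ≡ map suc (valleyLevels A)
valleyLevels-▸end end         = ≡.refl
valleyLevels-▸end (U A)       = valleyLevels-▸end A
valleyLevels-▸end (D end)     = ≡.refl
valleyLevels-▸end (D (U A))   = cong (_ ∷_) (valleyLevels-▸end (U A))
valleyLevels-▸end (D (D A))   = valleyLevels-▸end (D A)

valleyLevels-▸U : ∀ {h} (A : Path h) B →
                  valleyLevels (A ▸ U B) ≡ map suc (valleyLevels A) ++ 0 ∷ valleyLevels (U B)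
valleyLevels-▸U end       B = ≡.refl
valleyLevels-▸U (U A)     B = valleyLevels-▸U A B
valleyLevels-▸U (D end)   B = ≡.refl
valleyLevels-▸U (D (U A)) B = cong (_ ∷_) (valleyLevels-▸U (U A) B)
valleyLevels-▸U (D (D A)) B = valleyLevels-▸U (D A) B

module WeightedPaths {c ℓ} (R : CommutativeRing c ℓ) where

  open CommutativeRing R hiding (zero)
  open SemiringSum semiring
  open SetoidReasoning setoid
  open PowerSeries R

  -- The sum of F over the entries of a list.
  ∑∈ : ∀ {a} {A : Set a} → List A → (A → Carrier) → Carrier
  ∑∈ xs F = foldr (λ p s → F p + s) 0# xs

  module _ {a} {A : Set a} where

    ∑∈-cong : ∀ (xs : List A) {F G} → (∀ p → F p ≈ G p) → ∑∈ xs F ≈ ∑∈ xs G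
    ∑∈-cong []       F≈G = refl
    ∑∈-cong (p ∷ xs) F≈G = +-cong (F≈G p) (∑∈-cong xs F≈G)

    ∑∈-++ : ∀ (xs {ys} : List A) F → ∑∈ (xs ++ ys) F ≈ ∑∈ xs F + ∑∈ ys F
    ∑∈-++ []       F = sym (+-identityˡ _)
    ∑∈-++ (p ∷ xs) F = trans (+-congˡ (∑∈-++ xs F)) (sym (+-assoc _ _ _))

    ∑∈-map : ∀ {b} {B : Set b} (f : B → A) xs F → ∑∈ (map f xs) F ≈ ∑∈ xs (F ∘ f)
    ∑∈-map f []       F = refl
    ∑∈-map f (p ∷ xs) F = +-congˡ (∑∈-map f xs F)

    ∑∈-+ : ∀ (xs : List A) F G → ∑∈ xs (λ p → F p + G p) ≈ ∑∈ xs F + ∑∈ xs G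
    ∑∈-+ []       F G = sym (+-identityˡ _)
    ∑∈-+ (p ∷ xs) F G = trans (+-congˡ (∑∈-+ xs F G)) (interchange _ _ _ _)
      where open CommutativeSemigroupProperties +-commutativeSemigroup using (interchange)

    ∑∈-0 : ∀ (xs : List A) → ∑∈ xs (λ _ → 0#) ≈ 0#
    ∑∈-0 []       = refl
    ∑∈-0 (p ∷ xs) = trans (+-identityˡ _) (∑∈-0 xs)

    *-distribˡ-∑∈ : ∀ r (xs : List A) F → r * ∑∈ xs F ≈ ∑∈ xs (λ p → r * F p)
    *-distribˡ-∑∈ r []       F = zeroʳ r
    *-distribˡ-∑∈ r (p ∷ xs) F = trans (distribˡ _ _ _) (+-congˡ (*-distribˡ-∑∈ r xs F))

    *-distribʳ-∑∈ : ∀ r (xs : List A) F → ∑∈ xs F * r ≈ ∑∈ xs (λ p → F p * r)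
    *-distribʳ-∑∈ r []       F = zeroˡ r
    *-distribʳ-∑∈ r (p ∷ xs) F = trans (distribʳ _ _ _) (+-congˡ (*-distribʳ-∑∈ r xs F))

  -- The sum of F (A ▸ B) over the Dyck paths B of semi-length n.
  ∑▸ : ∀ {h} → (Path (suc h) → Carrier) → ℕ → Path h → Carrier
  ∑▸ F n A = ∑∈ (paths n 0) λ B → F (A ▸ B)

  -- Every path from height suc h is A ▸ B for exactly one A and B: the D
  -- between them is the first step that reaches the x-axis.  The
  -- induction follows the recursion of paths, on the first step.
  ∑∈-paths-split : ∀ n h (F : Path (suc h) → Carrier) →
    ∑∈ (paths n (suc h)) F ≈ ∑[ i ≤ n ] ∑∈ (paths (toℕ i) h) (∑▸ F (n ∸ toℕ i))
  ∑∈-paths-split zero zero F = trans (sym (+-identityʳ _)) (sym (+-identityʳ _))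
  ∑∈-paths-split zero (suc h) F = begin
    ∑∈ (map D (paths 0 (suc h))) F           ≈⟨ ∑∈-map D (paths 0 (suc h)) F ⟩
    ∑∈ (paths 0 (suc h)) (F ∘ D)             ≈⟨ ∑∈-paths-split zero h (F ∘ D) ⟩
    ∑∈ (paths 0 h) (∑▸ (F ∘ D) 0) + 0#       ≈⟨ +-congʳ (∑∈-map D (paths 0 h) (∑▸ F 0)) ⟨
    ∑∈ (map D (paths 0 h)) (∑▸ F 0) + 0#     ∎
  ∑∈-paths-split (suc n) zero F = begin
    ∑∈ (map U (paths n 2) ++ map D (paths (suc n) 0)) F
      ≈⟨ ∑∈-++ (map U (paths n 2)) F ⟩
    ∑∈ (map U (paths n 2)) F + ∑∈ (map D (paths (suc n) 0)) F
      ≈⟨ +-comm _ _ ⟩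
    ∑∈ (map D (paths (suc n) 0)) F + ∑∈ (map U (paths n 2)) F
      ≈⟨ +-cong (∑∈-map D (paths (suc n) 0) F)
                (trans (∑∈-map U (paths n 2) F) (∑∈-paths-split n 1 (F ∘ U))) ⟩
    ∑▸ F (suc n) end + (∑[ i ≤ n ] ∑∈ (paths (toℕ i) 1) (∑▸ (F ∘ U) (n ∸ toℕ i)))
      ≈⟨ +-cong (+-identityʳ _)
                (sum-cong-≋ {suc n} λ i → ∑∈-map U (paths (toℕ i) 1) (∑▸ F (n ∸ toℕ i))) ⟨
    (∑[ i ≤ suc n ] ∑∈ (paths (toℕ i) 0) (∑▸ F (suc n ∸ toℕ i))) ∎
  ∑∈-paths-split (suc n) (suc h) F = begin
    ∑∈ (map U (paths n (3+ h)) ++ map D (paths (suc n) (suc h))) F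
      ≈⟨ ∑∈-++ (map U (paths n (3+ h))) F ⟩
    ∑∈ (map U (paths n (3+ h))) F + ∑∈ (map D (paths (suc n) (suc h))) F
      ≈⟨ +-cong (trans (∑∈-map U (paths n _) F) (∑∈-paths-split n (suc (suc h)) (F ∘ U)))
                (trans (∑∈-map D (paths (suc n) _) F) (∑∈-paths-split (suc n) h (F ∘ D))) ⟩
    sum upward + (downward zero + sum (downward ∘ suc))
      ≈⟨ x∙yz≈y∙xz _ _ _ ⟩
    downward zero + (sum upward + sum (downward ∘ suc))
      ≈⟨ +-cong (∑∈-map D (paths 0 h) (∑▸ F (suc n)))
                (trans (sum-cong-≋ {suc n} firstStep) (∑-distrib-+ {suc n} upward (downward ∘ suc))) ⟨
    (∑[ i ≤ suc n ] ∑∈ (paths (toℕ i) (suc h)) (∑▸ F (suc n ∸ toℕ i))) ∎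
    where
    open CommutativeSemigroupProperties +-commutativeSemigroup using (x∙yz≈y∙xz)

    3+ : ℕ → ℕ
    3+ k = suc (suc (suc k))

    upward : Fin (suc n) → Carrier
    upward i = ∑∈ (paths (toℕ i) (suc (suc h))) (∑▸ (F ∘ U) (n ∸ toℕ i))

    downward : Fin (suc (suc n)) → Carrier
    downward i = ∑∈ (paths (toℕ i) h) (∑▸ (F ∘ D) (suc n ∸ toℕ i))

    firstStep : ∀ i → ∑∈ (paths (suc (toℕ i)) (suc h)) (∑▸ F (n ∸ toℕ i))
                      ≈ upward i + downward (suc i)
    firstStep i = trans
      (∑∈-++ (map U (paths (toℕ i) _)) _)
      (+-cong (∑∈-map U (paths (toℕ i) _) (∑▸ F (n ∸ toℕ i)))
              (∑∈-map D (paths (suc (toℕ i)) h) (∑▸ F (n ∸ toℕ i))))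

  -- The indicator of a truth value.
  𝟙 : Bool → Carrier
  𝟙 b = if b then 1# else 0#

  𝟙-∧ : ∀ a b → 𝟙 (a ∧ b) ≈ 𝟙 a * 𝟙 b
  𝟙-∧ true  b = sym (*-identityˡ _)
  𝟙-∧ false b = sym (zeroˡ _)

  𝟙-cong : ∀ {a b} → a ≡ b → 𝟙 a ≈ 𝟙 b
  𝟙-cong = reflexive ∘ cong 𝟙

  -- The generating function Σ F(p) X^ℓ(p) over the Dyck paths p of a
  -- weight F, where ℓ is the semi-length.
  gf : (DyckPath → Carrier) → R⟦X⟧
  gf F n = ∑∈ (paths n 0) F

  gf-cong : ∀ F G → (∀ p → F p ≈ G p) → gf F ≋ gf G
  gf-cong _ _ F≈G n = ∑∈-cong (paths n 0) F≈G

  gf-+ : ∀ F G → gf (λ p → F p + G p) ≋ gf F ⊕ gf G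
  gf-+ F G n = ∑∈-+ (paths n 0) F G

  gf-constant : ∀ {F G r} → F end ≈ r + G end → (∀ p → F (U p) ≈ G (U p)) →
                gf F ≋ constant r ⊕ gf G
  gf-constant F-end F-U zero    = trans (+-congʳ F-end) (+-assoc _ _ _)
  gf-constant {F} {G} F-end F-U (suc n) = begin
    ∑∈ (map U (paths n 1)) F      ≈⟨ ∑∈-map U (paths n 1) F ⟩
    ∑∈ (paths n 1) (F ∘ U)        ≈⟨ ∑∈-cong (paths n 1) F-U ⟩
    ∑∈ (paths n 1) (G ∘ U)        ≈⟨ ∑∈-map U (paths n 1) G ⟨
    ∑∈ (map U (paths n 1)) G      ≈⟨ +-identityˡ _ ⟨
    0# + ∑∈ (map U (paths n 1)) G ∎

  gf-∅ : ∀ {F} → (∀ p → F p ≈ 0#) → gf F ≋ 0S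
  gf-∅ F≈0 n = trans (∑∈-cong (paths n 0) F≈0) (∑∈-0 (paths n 0))

  -- The weight of the empty path alone.
  δ : DyckPath → Carrier
  δ end   = 1#
  δ (U _) = 0#

  gf-δ : gf δ ≋ 1S
  gf-δ n = trans (gf-constant (sym (+-identityʳ 1#)) (λ _ → refl) n)
                 (trans (+-congˡ (gf-∅ (λ _ → refl) n)) (+-identityʳ _))

  -- The weight of a nonempty path is split at its first return to the
  -- x-axis.  Both summands are products of a function of A and a function
  -- of B, and the first one vanishes unless B is empty.
  gf-firstReturn : ∀ {F f₁ f g} → F end ≈ 0# →
    (∀ A B → F (U (A ▸ B)) ≈ f₁ A * δ B + f A * g B) →
    gf F ≋ X ⊛ (gf f₁ ⊕ gf f ⊛ gf g)
  gf-firstReturn {F} {f₁} {f} {g} F-end F-U▸ zero =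
    trans (trans (+-identityʳ _) F-end) (sym (X⊛-zero (gf f₁ ⊕ gf f ⊛ gf g)))
  gf-firstReturn {F} {f₁} {f} {g} F-end F-U▸ (suc n) = begin
    ∑∈ (map U (paths n 1)) F
      ≈⟨ ∑∈-map U (paths n 1) F ⟩
    ∑∈ (paths n 1) (F ∘ U)
      ≈⟨ ∑∈-paths-split n 0 (F ∘ U) ⟩
    (∑[ i ≤ n ] ∑∈ (paths (toℕ i) 0) (∑▸ (F ∘ U) (n ∸ toℕ i)))
      ≈⟨ sum-cong-≋ {suc n} (λ i → factor (toℕ i) (n ∸ toℕ i)) ⟩
    (∑[ i ≤ n ] (term (gf f₁) (gf δ) n i + term (gf f) (gf g) n i))
      ≈⟨ ∑-distrib-+ {suc n} (term (gf f₁) (gf δ) n) (term (gf f) (gf g) n) ⟩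
    (gf f₁ ⊛ gf δ) n + (gf f ⊛ gf g) n
      ≈⟨ +-congʳ (⊛-cong {gf f₁} (λ _ → refl) gf-δ n) ⟩
    (gf f₁ ⊛ 1S) n + (gf f ⊛ gf g) n
      ≈⟨ +-congʳ (⊛-identityʳ (gf f₁) n) ⟩
    gf f₁ n + (gf f ⊛ gf g) n
      ≈⟨ X⊛-suc (gf f₁ ⊕ gf f ⊛ gf g) n ⟨
    (X ⊛ (gf f₁ ⊕ gf f ⊛ gf g)) (suc n) ∎
    where
    factor : ∀ i j → ∑∈ (paths i 0) (∑▸ (F ∘ U) j) ≈ gf f₁ i * gf δ j + gf f i * gf g j
    factor i j = begin
      ∑∈ (paths i 0) (∑▸ (F ∘ U) j)
        ≈⟨ ∑∈-cong (paths i 0) (λ A → trans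
             (∑∈-cong (paths j 0) (F-U▸ A))
             (trans (∑∈-+ (paths j 0) _ _)
                    (sym (+-cong (*-distribˡ-∑∈ (f₁ A) (paths j 0) δ)
                                 (*-distribˡ-∑∈ (f A) (paths j 0) g))))) ⟩
      ∑∈ (paths i 0) (λ A → f₁ A * gf δ j + f A * gf g j)
        ≈⟨ ∑∈-+ (paths i 0) _ _ ⟩
      ∑∈ (paths i 0) (λ A → f₁ A * gf δ j) + ∑∈ (paths i 0) (λ A → f A * gf g j)
        ≈⟨ +-cong (*-distribʳ-∑∈ (gf δ j) (paths i 0) f₁)
                  (*-distribʳ-∑∈ (gf g j) (paths i 0) f) ⟨
      gf f₁ i * gf δ j + gf f i * gf g j ∎

-- The element t marks the peaks.
module PeaksAndValleys {c ℓ} (R : CommutativeRing c ℓ) (t : CommutativeRing.Carrier R) where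

  open CommutativeRing R hiding (zero)
  open SemiringSum semiring
  open SemiringExp semiring using (_^_; ^-homo-*)
  open CommutativeSemigroupProperties *-commutativeSemigroup using (interchange)
  open SetoidReasoning setoid
  open PowerSeries R
  open WeightedPaths R

  -- The weight φ(ν) t^ρ of a nonempty path, where ν is its list of valley
  -- levels and ρ its number of peaks; the empty path has weight zero.
  mark : (List ℕ → Carrier) → DyckPath → Carrier
  mark φ end     = 0#
  mark φ p@(U _) = φ (valleyLevels p) * t ^ peaks p

  -- The weight of A that accounts for U A D: t counts the peaks of U A D,
  -- while φ is still applied to the valley levels of A.  Unlike for mark,
  -- the empty path A has a weight, namely φ [] t.
  mark⁺ : (List ℕ → Carrier) → DyckPath → Carrier
  mark⁺ φ p = φ (valleyLevels p) * t ^ peaks⁺ p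

  -- The valley levels of U (A ▸ B) are map suc ls if B is empty, and
  -- map suc ls ++ 0 ∷ ms otherwise, where ls and ms are those of A and B.
  gf-mark-firstReturn : ∀ {φ φ₁ ψ θ} →
    (∀ ls → φ (map suc ls) ≈ φ₁ ls) →
    (∀ ls ms → φ (map suc ls ++ 0 ∷ ms) ≈ ψ ls * θ ms) →
    gf (mark φ) ≋ X ⊛ (gf (mark⁺ φ₁) ⊕ gf (mark⁺ ψ) ⊛ gf (mark θ))
  gf-mark-firstReturn {φ} {φ₁} {ψ} {θ} φ-map φ-++ = gf-firstReturn refl split
    where
    split : ∀ A B → mark φ (U (A ▸ B)) ≈ mark⁺ φ₁ A * δ B + mark⁺ ψ A * mark θ B
    split A end = begin
      φ (valleyLevels (A ▸ end)) * t ^ peaks⁺ A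
        ≡⟨ cong (λ ls → φ ls * t ^ peaks⁺ A) (valleyLevels-▸end A) ⟩
      φ (map suc (valleyLevels A)) * t ^ peaks⁺ A
        ≈⟨ *-congʳ (φ-map (valleyLevels A)) ⟩
      mark⁺ φ₁ A
        ≈⟨ trans (+-cong (*-identityʳ _) (zeroʳ _)) (+-identityʳ _) ⟨
      mark⁺ φ₁ A * 1# + mark⁺ ψ A * 0# ∎
    split A B@(U B′) = begin
      φ (valleyLevels (A ▸ B)) * t ^ peaks (U (A ▸ B))
        ≡⟨ ≡.cong₂ (λ ls k → φ ls * t ^ k) (valleyLevels-▸U A B′) (peaks-U▸ A B) ⟩
      φ (map suc (valleyLevels A) ++ 0 ∷ valleyLevels B) * t ^ (peaks⁺ A ℕ.+ peaks B)
        ≈⟨ *-cong (φ-++ (valleyLevels A) (valleyLevels B)) (^-homo-* t (peaks⁺ A) (peaks B)) ⟩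
      (ψ (valleyLevels A) * θ (valleyLevels B)) * (t ^ peaks⁺ A * t ^ peaks B)
        ≈⟨ interchange _ _ _ _ ⟩
      mark⁺ ψ A * mark θ B
        ≈⟨ trans (+-congʳ (zeroʳ _)) (+-identityˡ _) ⟨
      mark⁺ φ₁ A * 0# + mark⁺ ψ A * mark θ B ∎

  gf-mark⁺ : ∀ φ {r} → φ [] * t ≈ r → gf (mark⁺ φ) ≋ constant r ⊕ gf (mark φ)
  gf-mark⁺ φ φ[]t = gf-constant
    (trans (*-congˡ (*-identityʳ t)) (trans φ[]t (sym (+-identityʳ _))))
    (λ p → reflexive (cong (λ k → φ (valleyLevels p) * t ^ k) (peaks⁺-U p)))

  gf-mark-cong : ∀ {φ ψ} → (∀ ls → φ ls ≈ ψ ls) → gf (mark φ) ≋ gf (mark ψ)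
  gf-mark-cong {φ} {ψ} φ≈ψ = gf-cong (mark φ) (mark ψ) λ where
    end     → refl
    p@(U _) → *-congʳ (φ≈ψ (valleyLevels p))

  gf-mark-+ : ∀ φ ψ → gf (mark (λ ls → φ ls + ψ ls)) ≋ gf (mark φ) ⊕ gf (mark ψ)
  gf-mark-+ φ ψ n = trans (gf-cong _ _ pointwise n) (gf-+ (mark φ) (mark ψ) n)
    where
    pointwise : ∀ p → mark (λ ls → φ ls + ψ ls) p ≈ mark φ p + mark ψ p
    pointwise end     = sym (+-identityʳ _)
    pointwise p@(U _) = distribʳ _ _ _

  gf-mark-0 : gf (mark (λ _ → 0#)) ≋ 0S
  gf-mark-0 = gf-∅ λ where
    end   → refl
    (U p) → zeroˡ _

  gf-mark-sum : ∀ {m} (φ : Fin m → List ℕ → Carrier) →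
    gf (mark (λ ls → ∑[ i < m ] φ i ls)) ≋ SeriesSum.sum (λ i → gf (mark (φ i)))
  gf-mark-sum {zero}  φ   = gf-mark-0
  gf-mark-sum {suc m} φ n = trans
    (gf-mark-+ (φ zero) (λ ls → ∑[ i < m ] φ (suc i) ls) n)
    (+-congˡ (gf-mark-sum (λ i → φ (suc i)) n))

-- Conditions on the levels of valleys

-- The case d = -[1+ m ], e = suc m.
module ValleyConditions (m : ℕ) where

  -- A valley at level a may be followed by one at level b.
  _≼_ : ℕ → ℕ → Bool
  a ≼ b = does (-[1+ m ] ℤ.≤? + b ℤ.- + a)

  -- The list can be that of the valley levels of a d-Dyck path.
  isChain : List ℕ → Bool
  isChain ls = does (linked? (λ a b → -[1+ m ] ℤ.≤? + b ℤ.- + a) ls)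

  -- The list is nonempty with last entry i.
  lastIs : ℕ → List ℕ → Bool
  lastIs i ls = does (≡-dec ℕ._≟_ (last ls) (just i))

  -- The last entry, if there is one, is below e.
  lastBelow : ℕ → List ℕ → Bool
  lastBelow e ls = maybe′ (ℕ._<ᵇ e) true (last ls)

  suc-≼-suc : ∀ a b → suc a ≼ suc b ≡ a ≼ b
  suc-≼-suc a b = cong (λ z → does (-[1+ m ] ℤ.≤? z))
    (≡.trans (ℤ.[1+m]⊖[1+n]≡m⊖n b a) (≡.sym (ℤ.m-n≡m⊖n b a)))

  0≼ : ∀ b → 0 ≼ b ≡ true
  0≼ zero    = ≡.refl
  0≼ (suc b) = ≡.refl

  suc≼0 : ∀ a → suc a ≼ 0 ≡ (a ℕ.<ᵇ suc m)
  suc≼0 zero    = ≡.refl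
  suc≼0 (suc a) = ≡.refl

  isChain-map-suc : ∀ ls → isChain (map suc ls) ≡ isChain ls
  isChain-map-suc []           = ≡.refl
  isChain-map-suc (a ∷ [])     = ≡.refl
  isChain-map-suc (a ∷ b ∷ ls) = cong₂ _∧_ (suc-≼-suc a b) (isChain-map-suc (b ∷ ls))

  isChain-0∷ : ∀ ls → isChain (0 ∷ ls) ≡ isChain ls
  isChain-0∷ []       = ≡.refl
  isChain-0∷ (b ∷ ls) = cong (_∧ isChain (b ∷ ls)) (0≼ b)

  -- A valley at level 0 may be followed by any valley, but restricts the
  -- valley before it.
  isChain-++ : ∀ ls ms → isChain (map suc ls ++ 0 ∷ ms) ≡
               (isChain ls ∧ lastBelow (suc m) ls) ∧ isChain ms
  isChain-++ []           ms = isChain-0∷ ms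
  isChain-++ (a ∷ [])     ms = cong₂ _∧_ (suc≼0 a) (isChain-0∷ ms)
  isChain-++ (a ∷ b ∷ ls) ms = ≡.trans
    (cong₂ _∧_ (suc-≼-suc a b) (isChain-++ (b ∷ ls) ms))
    (≡.trans
      (≡.sym (Bool.∧-assoc (a ≼ b) (isChain (b ∷ ls) ∧ lastBelow (suc m) (b ∷ ls)) (isChain ms)))
      (cong (_∧ isChain ms)
        (≡.sym (Bool.∧-assoc (a ≼ b) (isChain (b ∷ ls)) (lastBelow (suc m) (b ∷ ls))))))

  last-++-∷ : ∀ {a} {A : Set a} (xs : List A) y ys → last (xs ++ y ∷ ys) ≡ last (y ∷ ys)
  last-++-∷ []           y ys = ≡.refl
  last-++-∷ (x ∷ [])     y ys = ≡.refl
  last-++-∷ (x ∷ z ∷ xs) y ys = last-++-∷ (z ∷ xs) y ys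

  lastIs-zero-map-suc : ∀ ls → lastIs 0 (map suc ls) ≡ false
  lastIs-zero-map-suc []           = ≡.refl
  lastIs-zero-map-suc (a ∷ [])     = ≡.refl
  lastIs-zero-map-suc (a ∷ b ∷ ls) = lastIs-zero-map-suc (b ∷ ls)

  lastIs-suc-map-suc : ∀ i ls → lastIs (suc i) (map suc ls) ≡ lastIs i ls
  lastIs-suc-map-suc i []           = ≡.refl
  lastIs-suc-map-suc i (a ∷ [])     = ≡.refl
  lastIs-suc-map-suc i (a ∷ b ∷ ls) = lastIs-suc-map-suc i (b ∷ ls)

  lastIs-++ : ∀ i ls ms → lastIs i (map suc ls ++ 0 ∷ ms) ≡ lastIs i (0 ∷ ms)
  lastIs-++ i ls ms = cong (λ k → does (≡-dec ℕ._≟_ k (just i))) (last-++-∷ (map suc ls) 0 ms)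

module GeneratingFunctions
  (m : ℕ) {c ℓ} (R : CommutativeRing c ℓ) (t : CommutativeRing.Carrier R) where

  open ValleyConditions m
  open CommutativeRing R hiding (zero)
  open SemiringSum semiring
  open PowerSeries R
  open WeightedPaths R
  open PeaksAndValleys R t

  -- The indicator functions of the lists of valley levels of d-Dyck paths,
  -- of paths without valleys, and of d-Dyck paths with last valley at level
  -- i, or with last valley, if there is one, below level e.
  dyck noValley : List ℕ → Carrier
  dyck ls     = 𝟙 (isChain ls)
  noValley ls = 𝟙 (null ls)

  dyckAt dyckBelow : ℕ → List ℕ → Carrier
  dyckAt i ls    = 𝟙 (isChain ls ∧ lastIs i ls)
  dyckBelow e ls = 𝟙 (isChain ls ∧ lastBelow e ls)

  -- The series L, N, S and Q i, where N counts the nonempty paths without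
  -- valleys.
  ℒ 𝒩 𝒮 : R⟦X⟧
  ℒ = gf (mark dyck)
  𝒩 = gf (mark noValley)
  𝒮 = gf (mark⁺ (dyckBelow (suc m)))

  𝒬 : ℕ → R⟦X⟧
  𝒬 i = gf (mark (dyckAt i))

  mark⁺-1 : ∀ φ → φ [] ≈ 1# → gf (mark⁺ φ) ≋ constant t ⊕ gf (mark φ)
  mark⁺-1 φ φ[] = gf-mark⁺ φ (trans (*-congʳ φ[]) (*-identityˡ t))

  mark⁺-0 : ∀ φ → φ [] ≈ 0# → gf (mark⁺ φ) ≋ gf (mark φ)
  mark⁺-0 φ φ[] = Series.trans (gf-mark⁺ φ (trans (*-congʳ φ[]) (zeroˡ t))) λ where
    zero    → +-identityˡ _
    (suc n) → +-identityˡ _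

  ℒ-equation : ℒ ≋ X ⊛ ((constant t ⊕ ℒ) ⊕ 𝒮 ⊛ ℒ)
  ℒ-equation = Series.trans
    (gf-mark-firstReturn {dyck} {dyck} {dyckBelow (suc m)} {dyck}
      (λ ls → 𝟙-cong (isChain-map-suc ls))
      (λ ls ms → trans (𝟙-cong (isChain-++ ls ms)) (𝟙-∧ _ (isChain ms))))
    (Series.*-congˡ {X} (Series.+-congʳ (mark⁺-1 dyck refl)))

  𝒩-equation : 𝒩 ≋ X ⊛ (constant t ⊕ 𝒩)
  𝒩-equation = Series.trans
    (gf-mark-firstReturn {noValley} {noValley} {λ _ → 0#} {λ _ → 0#}
      (λ { [] → refl ; (_ ∷ _) → refl })
      (λ { [] ms → sym (zeroˡ _) ; (_ ∷ _) ms → sym (zeroˡ _) }))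
    (Series.*-congˡ {X} (Series.trans
      (Series.+-cong (mark⁺-1 noValley refl) (⊛-zeroˡ (gf-∅ (λ p → zeroˡ _)) _))
      (Series.+-identityʳ (constant t ⊕ 𝒩))))

  -- The condition on A in U A D B with B nonempty is separated from the one
  -- on B; the truth value b stands for a further condition on B.
  𝟙-dyckBelow : ∀ ls ms {b} → 𝟙 (isChain (map suc ls ++ 0 ∷ ms) ∧ b)
                 ≈ dyckBelow (suc m) ls * 𝟙 (isChain ms ∧ b)
  𝟙-dyckBelow ls ms {b} = trans
    (𝟙-cong (≡.trans (cong (_∧ b) (isChain-++ ls ms))
                     (Bool.∧-assoc (isChain ls ∧ lastBelow (suc m) ls) (isChain ms) b)))
    (𝟙-∧ (isChain ls ∧ lastBelow (suc m) ls) (isChain ms ∧ b))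

  -- The last valley of U A D B is at level 0 just when B is nonempty and has
  -- either no valley or its last valley at level 0.
  𝒬₀-equation : 𝒬 0 ≋ X ⊛ (𝒮 ⊛ (𝒩 ⊕ 𝒬 0))
  𝒬₀-equation = Series.trans
    (gf-mark-firstReturn {dyckAt 0} {λ _ → 0#} {dyckBelow (suc m)}
      {λ ls → noValley ls + dyckAt 0 ls}
      (λ ls → 𝟙-cong (≡.trans (cong (isChain (map suc ls) ∧_) (lastIs-zero-map-suc ls))
                              (Bool.∧-zeroʳ _)))
      (λ ls ms → trans
        (𝟙-cong (cong (isChain (map suc ls ++ 0 ∷ ms) ∧_) (lastIs-++ 0 ls ms)))
        (trans (𝟙-dyckBelow ls ms) (*-congˡ (last-0∷ ms)))))
    (Series.*-congˡ {X} (Series.trans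
      (Series.+-cong
        (gf-∅ (λ p → zeroˡ _))
        (Series.*-congˡ {𝒮} (gf-mark-+ noValley (dyckAt 0))))
      (Series.+-identityˡ (𝒮 ⊛ (𝒩 ⊕ 𝒬 0)))))
    where
    last-0∷ : ∀ ms → 𝟙 (isChain ms ∧ lastIs 0 (0 ∷ ms)) ≈ noValley ms + dyckAt 0 ms
    last-0∷ []       = sym (+-identityʳ _)
    last-0∷ (b ∷ ms) = sym (+-identityˡ _)

  -- The last valley of U A D B at level i + 1 is that of A, raised, if B is
  -- empty, and that of B otherwise.
  𝒬-suc-equation : ∀ i → 𝒬 (suc i) ≋ X ⊛ (𝒬 i ⊕ 𝒮 ⊛ 𝒬 (suc i))
  𝒬-suc-equation i = Series.trans
    (gf-mark-firstReturn {dyckAt (suc i)} {dyckAt i} {dyckBelow (suc m)} {dyckAt (suc i)}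
      (λ ls → 𝟙-cong (cong₂ _∧_ (isChain-map-suc ls) (lastIs-suc-map-suc i ls)))
      (λ ls ms → trans
        (𝟙-cong (cong (isChain (map suc ls ++ 0 ∷ ms) ∧_) (lastIs-++ (suc i) ls ms)))
        (trans (𝟙-dyckBelow ls ms) (*-congˡ (𝟙-cong (cong (isChain ms ∧_) (last-0∷ ms)))))))
    (Series.*-congˡ {X} (Series.+-congʳ {𝒮 ⊛ 𝒬 (suc i)} (mark⁺-0 (dyckAt i) refl)))
    where
    last-0∷ : ∀ ms → lastIs (suc i) (0 ∷ ms) ≡ lastIs (suc i) ms
    last-0∷ []       = ≡.refl
    last-0∷ (b ∷ ms) = ≡.refl

  𝒮-equation : 𝒮 ≋ constant t ⊕ (𝒩 ⊕ SeriesSum.sum {suc m} λ j → 𝒬 (toℕ j))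
  𝒮-equation = Series.trans
    (mark⁺-1 (dyckBelow (suc m)) refl)
    (Series.+-congˡ {constant t} (Series.trans
      (gf-mark-cong (decompose (suc m)))
      (Series.trans
        (gf-mark-+ noValley (λ ls → ∑[ j < suc m ] dyckAt (toℕ j) ls))
        (Series.+-congˡ {𝒩} (gf-mark-sum {suc m} (λ j → dyckAt (toℕ j)))))))
    where
    sum-∧-false : ∀ e b → ∑[ j < e ] 𝟙 (b ∧ false) ≈ 0#
    sum-∧-false e b = trans (sum-cong-≋ {e} (λ j → 𝟙-cong (Bool.∧-zeroʳ b)))
                            (sum-replicate-zero e)

    -- Only the summand at j = i can be nonzero, and it occurs just when i is
    -- below e.
    <-sum : ∀ e i b → 𝟙 (b ∧ (i ℕ.<ᵇ e)) ≈ ∑[ j < e ] 𝟙 (b ∧ does (i ℕ.≟ toℕ j))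
    <-sum zero    i       b = 𝟙-cong (Bool.∧-zeroʳ b)
    <-sum (suc e) zero    b = sym (trans (+-congˡ (sum-∧-false e b)) (+-identityʳ _))
    <-sum (suc e) (suc i) b = trans (<-sum e i b)
      (sym (trans (+-congʳ (𝟙-cong (Bool.∧-zeroʳ b))) (+-identityˡ _)))

    isNothing : Maybe ℕ → Bool
    isNothing = maybe′ (λ _ → false) true

    null-last : ∀ ls → isChain ls ∧ isNothing (last ls) ≡ null ls
    null-last []           = ≡.refl
    null-last (a ∷ [])     = ≡.refl
    null-last (a ∷ b ∷ ls) = ≡.trans (Bool.∧-assoc (a ≼ b) _ _)
      (≡.trans (cong ((a ≼ b) ∧_) (null-last (b ∷ ls))) (Bool.∧-zeroʳ (a ≼ b)))

    split-last : ∀ e ls → dyckBelow e ls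
                 ≈ 𝟙 (isChain ls ∧ isNothing (last ls)) + ∑[ j < e ] dyckAt (toℕ j) ls
    split-last e ls with last ls
    ... | nothing = sym (trans (+-congˡ (sum-∧-false e (isChain ls))) (+-identityʳ _))
    ... | just i  = trans (<-sum e i (isChain ls))
      (sym (trans (+-congʳ (𝟙-cong (Bool.∧-zeroʳ (isChain ls)))) (+-identityˡ _)))

    decompose : ∀ e ls → dyckBelow e ls ≈ noValley ls + ∑[ j < e ] dyckAt (toℕ j) ls
    decompose e ls = trans (split-last e ls) (+-congʳ (𝟙-cong (null-last ls)))

-- The ring of series in x and y

open import Defs
open import Data.Integer.Base using (ℤ; ∣_∣; 0ℤ; _<_)
open import Data.Nat.Base using (suc)
open import Data.Product.Base using (_×_)

-- A series f in x and y is read as the series in X whose coefficient of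
-- Xⁿ is the series in Y with coefficients f n, so that x and y become X
-- and constant Y.X.
module Y = PowerSeries ℤ.+-*-commutativeRing

open PowerSeries Y.R⟦X⟧-commutativeRing
  using (_⊛_; constant; X; 0S; 1S; term; X⊛-zero; X⊛-suc)
  renaming (module Series to Iterated; module SeriesSum to IteratedSum)

*-iterated : ∀ f g → f * g ≈ f ⊛ g
*-iterated f g n k = ≡.sym (Y.sum-coefficient (term f g n) k)

0#-iterated : 0# ≈ 0S
0#-iterated zero    zero    = ≡.refl
0#-iterated zero    (suc k) = ≡.refl
0#-iterated (suc n) k       = ≡.refl

1#-iterated : 1# ≈ 1S
1#-iterated zero    zero    = ≡.refl
1#-iterated zero    (suc k) = ≡.refl
1#-iterated (suc n) k       = ≡.refl

isRingMonomorphism : IsRingMonomorphism ℤ⟦x,y⟧ Iterated.rawRing (λ f → f)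
isRingMonomorphism = record
  { isRingHomomorphism = record
    { isSemiringHomomorphism = record
      { isNearSemiringHomomorphism = record
        { +-isMonoidHomomorphism = record
          { isMagmaHomomorphism = record
            { isRelHomomorphism = record { cong = λ f≈g → f≈g }
            ; homo              = λ f g n k → ≡.refl
            }
          ; ε-homo = 0#-iterated
          }
        ; *-homo = *-iterated
        }
      ; 1#-homo = 1#-iterated
      }
    ; -‿homo = λ f n k → ≡.refl
    }
  ; injective = λ f≈g → f≈g
  }

ℤ⟦x,y⟧-commutativeRing : CommutativeRing 0ℓ 0ℓ
ℤ⟦x,y⟧-commutativeRing = record
  { isCommutativeRing =
      RingMonomorphism.isCommutativeRing isRingMonomorphism Iterated.isCommutativeRing }

module XY = CommutativeRing ℤ⟦x,y⟧-commutativeRing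

x-iterated : x ≈ X
x-iterated zero          k       = ≡.refl
x-iterated (suc zero)    zero    = ≡.refl
x-iterated (suc zero)    (suc k) = ≡.refl
x-iterated (suc (suc n)) k       = ≡.refl

y-iterated : y ≈ constant Y.X
y-iterated zero    zero          = ≡.refl
y-iterated zero    (suc zero)    = ≡.refl
y-iterated zero    (suc (suc k)) = ≡.refl
y-iterated (suc n) k             = ≡.refl

sum-iterated : ∀ {m} {s t : Fin m → Series} → (∀ i → s i ≈ t i) →
               sum s ≈ IteratedSum.sum t
sum-iterated {zero}  s≈t = 0#-iterated
sum-iterated {suc m} s≈t = XY.+-cong (s≈t zero) (sum-iterated (s≈t ∘ suc))

x*-iterated : ∀ {f g} → f ≈ g → x * f ≈ X ⊛ g
x*-iterated {f} {g} f≈g = XY.trans (XY.*-cong x-iterated f≈g) (*-iterated X g)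

1/[1-x]-equation : 1/[1-x] ≈ 1# + x * 1/[1-x]
1/[1-x]-equation = XY.trans unfold
  (XY.sym (XY.+-cong 1#-iterated (x*-iterated {1/[1-x]} XY.refl)))
  where
  unfold : 1/[1-x] ≈ 1S + X ⊛ 1/[1-x]
  unfold zero    zero    = ≡.sym (cong₂ ℤ._+_ (≡.refl {x = 1ℤ}) (X⊛-zero 1/[1-x] 0))
  unfold zero    (suc k) = ≡.sym (cong₂ ℤ._+_ (≡.refl {x = 0ℤ}) (X⊛-zero 1/[1-x] (suc k)))
  unfold (suc n) k       = ≡.sym (≡.trans (ℤ.+-identityˡ _) (X⊛-suc 1/[1-x] n k))

-- The series counting Dyck paths

open SemiringExp Y.Series.semiring using () renaming (_^_ to _^Y_)
open WeightedPaths Y.R⟦X⟧-commutativeRing using (∑∈; gf; gf-cong; 𝟙)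
open PeaksAndValleys Y.R⟦X⟧-commutativeRing Y.X using (mark)

Y^-coefficient : ∀ m k → (Y.X ^Y m) k ≡ (if does (m ℕ.≟ k) then 1ℤ else 0ℤ)
Y^-coefficient zero    zero    = ≡.refl
Y^-coefficient zero    (suc k) = ≡.refl
Y^-coefficient (suc m) zero    = Y.X⊛-zero (Y.X ^Y m)
Y^-coefficient (suc m) (suc k) = ≡.trans (Y.X⊛-suc (Y.X ^Y m) k) (Y^-coefficient m k)

-- The monomial Y^ρ(p) if p satisfies P, and zero otherwise, where ρ is the
-- number of peaks.
weight : {P : Pred DyckPath 0ℓ} → Decidable P → DyckPath → Y.R⟦X⟧
weight P? p = 𝟙 (does (P? p)) Y.⊛ (Y.X ^Y peaks p)

weight-coefficient : ∀ {P : Pred DyckPath 0ℓ} (P? : Decidable P) p k →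
  weight P? p k ≡ (if does (P? p ×-dec (peaks p ℕ.≟ k)) then 1ℤ else 0ℤ)
weight-coefficient P? p k with does (P? p)
... | true  = ≡.trans (Y.⊛-identityˡ (Y.X ^Y peaks p) k) (Y^-coefficient (peaks p) k)
... | false = Y.Series.zeroˡ (Y.X ^Y peaks p) k

length-filter-∷ : ∀ {a p} {A : Set a} {P : Pred A p} (P? : Decidable P) z zs →
  + length (filter P? (z ∷ zs)) ≡ (if does (P? z) then 1ℤ else 0ℤ) ℤ.+ + length (filter P? zs)
length-filter-∷ P? z zs with does (P? z)
... | true  = ≡.refl
... | false = ≡.refl

genFun-gf : ∀ {P : Pred DyckPath 0ℓ} (P? : Decidable P) → genFun P? ≈ gf (weight P?)
genFun-gf P? n k = count (paths n 0)
  where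
  count : ∀ ps → + length (filter (λ p → P? p ×-dec (peaks p ℕ.≟ k)) ps)
                 ≡ ∑∈ ps (weight P?) k
  count []       = ≡.refl
  count (p ∷ ps) = ≡.trans
    (length-filter-∷ (λ p → P? p ×-dec (peaks p ℕ.≟ k)) p ps)
    (cong₂ ℤ._+_ (≡.sym (weight-coefficient P? p k)) (count ps))

module CountingSeries (m : ℕ) where

  open GeneratingFunctions m Y.R⟦X⟧-commutativeRing Y.X
  open FunctionalEquations ℤ⟦x,y⟧-commutativeRing using (geometric)
  open CommutativeSemigroupProperties XY.*-commutativeSemigroup using (x∙yz≈y∙xz)
  open SetoidReasoning XY.setoid

  d : ℤ
  d = -[1+ m ]

  L≈ℒ : L d ≈ ℒ
  L≈ℒ = XY.trans (genFun-gf L?) (gf-cong (weight L?) (mark dyck) λ where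
    end   → Y.Series.zeroˡ (Y.X ^Y 0)
    (U p) → Y.Series.refl)
    where
    L? = λ p → nonEmpty? p ×-dec isDyck? d p

  Q≈𝒬 : ∀ i → Q d i ≈ 𝒬 i
  Q≈𝒬 i = XY.trans (genFun-gf Q?) (gf-cong (weight Q?) (mark (dyckAt i)) λ where
    end   → Y.Series.zeroˡ (Y.X ^Y 0)
    (U p) → Y.Series.refl)
    where
    Q? = λ p → isDyck? d p ×-dec lastValleyAt? i p

  𝒩≈xy/[1-x] : 𝒩 ≈ x * (y * 1/[1-x])
  𝒩≈xy/[1-x] = geometric x 1/[1-x] y 𝒩 1/[1-x]-equation
    (XY.trans 𝒩-equation (XY.sym (x*-iterated {y + 𝒩} (XY.+-congʳ {𝒩} y-iterated))))

  y/[1-x]≈y+𝒩 : y * 1/[1-x] ≈ y + 𝒩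
  y/[1-x]≈y+𝒩 = begin
    y * 1/[1-x]                ≈⟨ XY.*-congˡ {y} 1/[1-x]-equation ⟩
    y * (1# + x * 1/[1-x])     ≈⟨ XY.distribˡ y 1# (x * 1/[1-x]) ⟩
    y * 1# + y * (x * 1/[1-x]) ≈⟨ XY.+-cong (XY.*-identityʳ y) (x∙yz≈y∙xz y x 1/[1-x]) ⟩
    y + x * (y * 1/[1-x])      ≈⟨ XY.+-congˡ {y} 𝒩≈xy/[1-x] ⟨
    y + 𝒩                      ∎

  S≈𝒮 : S d ≈ 𝒮
  S≈𝒮 = begin
    y * 1/[1-x] + ΣQ         ≈⟨ XY.+-congʳ {ΣQ} y/[1-x]≈y+𝒩 ⟩
    (y + 𝒩) + ΣQ             ≈⟨ XY.+-assoc y 𝒩 ΣQ ⟩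
    y + (𝒩 + ΣQ)             ≈⟨ XY.+-cong y-iterated (XY.+-congˡ {𝒩} (sum-iterated {suc m} λ j → Q≈𝒬 (toℕ j))) ⟩
    constant Y.X + (𝒩 + Σ𝒬)  ≈⟨ 𝒮-equation ⟨
    𝒮                        ∎
    where
    ΣQ = sum {suc m} λ j → Q d (toℕ j)
    Σ𝒬 = IteratedSum.sum {suc m} λ j → 𝒬 (toℕ j)

  S*-iterated : ∀ {f g} → f ≈ g → S d * f ≈ 𝒮 ⊛ g
  S*-iterated {f} {g} f≈g = XY.trans (XY.*-cong S≈𝒮 f≈g) (*-iterated 𝒮 g)

  L-equation : L d ≈ x * (y + L d + S d * L d)
  L-equation = XY.trans L≈ℒ (XY.trans ℒ-equation (XY.sym
    (x*-iterated {y + L d + S d * L d}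
      (XY.+-cong (XY.+-cong y-iterated L≈ℒ) (S*-iterated {L d} L≈ℒ)))))

  Q₀-equation : Q d 0 ≈ x * (S d * (𝒩 + Q d 0))
  Q₀-equation = XY.trans (Q≈𝒬 0) (XY.trans 𝒬₀-equation (XY.sym
    (x*-iterated {S d * (𝒩 + Q d 0)}
      (S*-iterated {𝒩 + Q d 0} (XY.+-congˡ {𝒩} (Q≈𝒬 0))))))

  Q-suc-equation : ∀ i → Q d (suc i) ≈ x * (Q d i + S d * Q d (suc i))
  Q-suc-equation i = XY.trans (Q≈𝒬 (suc i)) (XY.trans (𝒬-suc-equation i) (XY.sym
    (x*-iterated {Q d i + S d * Q d (suc i)}
      (XY.+-cong (Q≈𝒬 i) (S*-iterated {Q d (suc i)} (Q≈𝒬 (suc i)))))))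

theorem2p1 : (d : ℤ) → d < 0ℤ → let e = ∣ d ∣ in
    (L d ≈ x * y + x * L d + x * S d * L d)
    × ((1# - x * S d) ^ e * (y + (1# - y) * (x * S d))
    - S d * (1# - x * S d) ^ suc e
    - x ^ suc (suc e) * y * 1/[1-x] * S d
    ≈ 0#)
theorem2p1 (+ n)        (ℤ.+<+ ())
theorem2p1 d@(-[1+ m ]) _ =
    XY.trans L-equation (expand x y (L d) (S d))
  , elimination x y 1/[1-x] 𝒩 (Q d) (S d) (suc m)
      XY.refl 1/[1-x]-equation 𝒩≈xy/[1-x] Q₀-equation Q-suc-equation
  where
  open CountingSeries m using (L-equation; 𝒩≈xy/[1-x]; Q₀-equation; Q-suc-equation)
  open GeneratingFunctions m Y.R⟦X⟧-commutativeRing Y.X using (𝒩)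
  open FunctionalEquations ℤ⟦x,y⟧-commutativeRing using (expand; elimination)
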